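{- For every positive integer $k$, every $k$-tree is odd $\left(k+2\left\lfloor\log_2 k\right\rfloor+3\right)$-colorable.
   Context: All graphs are simple, finite and undirected. For a positive integer $m$, $[m]=\{1,\dots,m\}$. A $m$-coloring of a graph $G$ is a map $\varphi:V(G)\to[m]$ with $\varphi(u)\neq\varphi(v)$ for every edge $uv$ (a proper coloring). A vertex $v$ satisfies the odd condition with respect to $\varphi$ if $|\varphi^{ -1}(i)\cap N_G(v)|$ is odd for some color $i$. An odd $m$-coloring of $G$ is an $m$-coloring such that every non-isolated vertex satisfies the odd condition; $G$ is odd $m$-colorable if it has one. For a positive integer $k$, a graph $G$ is a $k$-tree if there is a sequence $G_0,G_1,\dots,G_s$ of induced subgraphs of $G$ with $G_0\cong K_{k+1}$, $G_s=G$, and for each $i\in[s]$, $V(G_i)=V(G_{i-1})\cup\{x_i\}$ for a new vertex $x_i$ whose set of neighbors in $V(G_{i-1})$ is a clique of order $k$ in $G$. -}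

module Defs where

open import Data.Nat using (ℕ; suc; _+_; _*_; _<_; _%_)
open import Data.Nat.Logarithm using (⌊log₂_⌋)
open import Data.Bool using (Bool; true; false; _∧_)
open import Data.Fin using (Fin; toℕ)
open import Data.List using (List; length; filterᵇ)
open import Data.List using () renaming (allFin to allFinL)
open import Data.Product using (Σ; ∃; ∃-syntax; _×_; _,_)
open import Relation.Binary.PropositionalEquality using (_≡_; _≢_)
open import Relation.Nullary using (¬_)
open import Relation.Nullary.Decidable using (⌊_⌋)
open import Function.Bundles using (_↔_; Inverse)
open import Data.Fin using (_≟_)

record Graph (n : ℕ) : Set where
  field
    adj   : Fin n → Fin n → Bool
    sym   : ∀ u v → adj u v ≡ adj v u
    irrefl : ∀ v → adj v v ≡ false
open Graph public

Edge : ∀ {n} → Graph n → Fin n → Fin n → Set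
Edge G u v = adj G u v ≡ true

nbColorCount : ∀ {n m} → Graph n → (Fin n → Fin m) → Fin n → Fin m → ℕ
nbColorCount {n} G φ v i =
  length (filterᵇ (λ u → adj G v u ∧ ⌊ φ u ≟ i ⌋ ) (allFinL n))


Isolated : ∀ {n} → Graph n → Fin n → Set
Isolated G v = ∀ u → adj G v u ≡ false

Odd : ℕ → Set
Odd a = a % 2 ≡ 1

IsColoring : ∀ {n m} → Graph n → (Fin n → Fin m) → Set
IsColoring G φ = ∀ u v → Edge G u v → φ u ≢ φ v

OddCondition : ∀ {n m} → Graph n → (Fin n → Fin m) → Fin n → Set
OddCondition G φ v = ∃[ i ] Odd (nbColorCount G φ v i)

IsOddColoring : ∀ {n m} → Graph n → (Fin n → Fin m) → Set
IsOddColoring G φ = IsColoring G φ × (∀ v → ¬ Isolated G v → OddCondition G φ v)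

OddColorable : ∀ {n} → ℕ → Graph n → Set
OddColorable {n} m G = Σ (Fin n → Fin m) (IsOddColoring G)

-- k-trees.  A graph on Fin (k + 1 + s) is a k-tree if there is an
-- enumeration σ (a bijection from positions to vertices) such that the
-- first k+1 positions x_0..x_k form a clique (G_0 ≅ K_{k+1}) and for each
-- later position p, the set of neighbours of σ p among earlier positions
-- is a clique of order exactly k.
IsKTree : (k : ℕ) → ∀ {n} → Graph n → Set
IsKTree k {n} G =
  Σ ℕ λ s → Σ (k + 1 + s ≡ n) λ _ → Σ (Fin n ↔ Fin n) λ σ →
    let x = Inverse.to σ in
    (∀ p q → toℕ p < suc k → toℕ q < suc k → p ≢ q → Edge G (x p) (x q))
    ×
    (∀ p → suc k Data.Nat.≤ toℕ p →
       (∀ q r → toℕ q < toℕ p → toℕ r < toℕ p → q ≢ r →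
          Edge G (x p) (x q) → Edge G (x p) (x r) → Edge G (x q) (x r))
       ×
       length (filterᵇ (λ q → Data.Nat._<ᵇ_ (toℕ q) (toℕ p) ∧ adj G (x p) (x q))
                      (allFinL n)) ≡ k)

{-# OPTIONS --safe #-}
module Submission where

-- Hang every later vertex w below its latest earlier neighbour, which gives a rooted tree of
-- cliques Q w of order k + 1, and put t = ⌊log₂ k⌋ + 1, so that k < 2 ^ t and t ≤ k.  Let p be
-- a deepest vertex and q its ancestor t levels up.  Delete everything below q and colour the
-- rest by induction.  There remain 2t colours not occurring on Q q.  Give the i-th level below
-- q its own pair αᵢ, βᵢ of these: all its vertices get αᵢ, except that the ancestor of p on this
-- level may get βᵢ.  A deleted vertex has a neighbour in Q q, whose colour it sees exactly once.
-- Each of the at most k vertices of Q q adjacent to p is left unsatisfied by at most one of the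
-- 2 ^ t choices along the path.  A vertex v of Q q not adjacent to p loses contact with the path
-- at some level, a different one for each v, so the βᵢ can be arranged so that the old
-- odd colour of v is some βᵢ from a level beyond that point, which v never sees again.
-- If no vertex has depth t, the same recolouring with q the root needs no care, because the
-- vertices of the root clique see each other's colours exactly once.

open import Defs hiding (sym)
open import Data.Nat using (ℕ; zero; suc; _+_; _*_; _∸_; _^_; _≤_; _<_; _<ᵇ_; _%_; z≤n; s≤s; s≤s⁻¹; _≤?_; _<?_)
open import Data.Nat.DivMod using ([m+n]%n≡m%n)
open import Data.Nat.Induction using (<-wellFounded; Acc; acc)
open import Data.Nat.Logarithm using (⌊log₂_⌋; ⌊log₂⌋-mono-≤; ⌊log₂[2^n]⌋≡n)
open import Data.Nat.Properties hiding (_≟_)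
open import Data.Nat.Solver using (module +-*-Solver)
open import Data.Bool using (Bool; true; false; not; _∧_; _∨_; _xor_; if_then_else_) renaming (_≟_ to _≟ᵇ_; T to True)
open import Data.Bool.Properties using (∧-conicalˡ; ∧-conicalʳ; xor-∧-commutativeRing; xor-identityʳ; T?)
open import Data.Fin using (Fin; zero; suc; toℕ; fromℕ<; _≟_)
open import Data.Fin.Properties using (toℕ-injective; toℕ-fromℕ<; pigeonhole; ¬∀⟶∃¬; any?)
import Data.Fin.Properties as Fin
open import Data.List using (List; _∷_; length; lookup; filterᵇ; tabulate; map; allFin)
open import Data.List.Properties using (length-map)
open import Data.List.Membership.Propositional using (_∈_; _∉_)
open import Data.List.Membership.Propositional.Properties using (∈-map⁺; ∈-filter⁺; ∈-allFin)
open import Data.List.Relation.Unary.Any using (here; there; index) renaming (any? to anyL?)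
open import Data.List.Relation.Unary.Any.Properties using (lookup-index)
open import Data.Product using (Σ; ∃-syntax; _×_; _,_; proj₁; proj₂)
import Data.Sum as Sum
open import Data.Sum using (_⊎_; inj₁; inj₂)
open import Data.Empty using (⊥; ⊥-elim)
open import Function using (_∘_; id; case_of_)
open import Function.Bundles using (Inverse)
open import Algebra.Bundles using (CommutativeRing)
import Algebra.Properties.CommutativeMonoid.Sum as CommutativeMonoidSum
open import Relation.Nullary using (¬_; Dec; yes; no; contradiction)
open import Relation.Nullary.Decidable using (⌊_⌋)
open import Relation.Binary.Definitions using (tri<; tri≈; tri>)
open import Relation.Binary.PropositionalEquality
open +-*-Solver using (solve; _:+_; _:*_; _:=_; con)

module ℕSum = CommutativeMonoidSum +-0-commutativeMonoid
module XorSum = CommutativeMonoidSum (CommutativeRing.+-commutativeMonoid xor-∧-commutativeRing)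

-- Booleans and decisions

∧⁺ : ∀ {a b} → a ≡ true → b ≡ true → a ∧ b ≡ true
∧⁺ refl refl = refl

∧⁻ : ∀ a {b} → a ∧ b ≡ true → a ≡ true × b ≡ true
∧⁻ true e = refl , e

∨⁻ : ∀ a {b} → a ∨ b ≡ true → a ≡ true ⊎ b ≡ true
∨⁻ true  _ = inj₁ refl
∨⁻ false e = inj₂ e

true≢false : ∀ {a} → a ≡ true → a ≡ false → ⊥
true≢false refl ()

¬true⇒false : ∀ {a} → ¬ (a ≡ true) → a ≡ false
¬true⇒false {true}  h = ⊥-elim (h refl)
¬true⇒false {false} _ = refl

⌊⌋⁺ : ∀ {p} {P : Set p} (d : Dec P) → P → ⌊ d ⌋ ≡ true
⌊⌋⁺ (yes _) _ = refl
⌊⌋⁺ (no ¬p) p = contradiction p ¬p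

⌊⌋⁻ : ∀ {p} {P : Set p} (d : Dec P) → ⌊ d ⌋ ≡ true → P
⌊⌋⁻ (yes p) _ = p

⌊⌋-false : ∀ {p} {P : Set p} (d : Dec P) → ¬ P → ⌊ d ⌋ ≡ false
⌊⌋-false d ¬p = ¬true⇒false (¬p ∘ ⌊⌋⁻ d)

<ᵇ⁺ : ∀ {m n} → m < n → (m <ᵇ n) ≡ true
<ᵇ⁺ {m} {n} p with m <ᵇ n | <⇒<ᵇ p
... | true | _ = refl

<ᵇ⁻ : ∀ {m n} → (m <ᵇ n) ≡ true → m < n
<ᵇ⁻ {m} {n} e = <ᵇ⇒< m n (subst True (sym e) _)

-- Counting and parity

bit : Bool → ℕ
bit b = if b then 1 else 0

cnt : ∀ {n} → (Fin n → Bool) → ℕ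
cnt f = ℕSum.sum (bit ∘ f)

-- As a sum in the group of Booleans under xor, parity inherits splitting of sums and invariance
-- under permutations from the general theory of finite sums.
parity : ∀ {n} → (Fin n → Bool) → Bool
parity = XorSum.sum

bit-mono : ∀ {a b} → (a ≡ true → b ≡ true) → bit a ≤ bit b
bit-mono {false} _ = z≤n
bit-mono {true}  h rewrite h refl = ≤-refl

bit-cover : ∀ {a b c} → (a ≡ true → b ≡ true ⊎ c ≡ true) → bit a ≤ bit b + bit c
bit-cover {false} _ = z≤n
bit-cover {true} {b} h with h refl
... | inj₁ refl = s≤s z≤n
... | inj₂ refl = m≤n+m 1 (bit b)

bit-disjoint : ∀ {a b c} → (a ≡ true → c ≡ true) → (b ≡ true → c ≡ true) →
               (a ≡ true → b ≡ true → ⊥) → bit a + bit b ≤ bit c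
bit-disjoint {false} _ g _ = bit-mono g
bit-disjoint {true} {false} f _ _ rewrite f refl = ≤-refl
bit-disjoint {true} {true} _ _ d = ⊥-elim (d refl refl)

sum-mono-≤ : ∀ {n} (a b : Fin n → ℕ) → (∀ i → a i ≤ b i) → ℕSum.sum a ≤ ℕSum.sum b
sum-mono-≤ {zero}  a b h = z≤n
sum-mono-≤ {suc n} a b h = +-mono-≤ (h zero) (sum-mono-≤ (a ∘ suc) (b ∘ suc) (h ∘ suc))

cnt-mono : ∀ {n} (f g : Fin n → Bool) → (∀ i → f i ≡ true → g i ≡ true) → cnt f ≤ cnt g
cnt-mono f g h = sum-mono-≤ (bit ∘ f) (bit ∘ g) (λ i → bit-mono (h i))

cnt-cover : ∀ {n} (f g h : Fin n → Bool) → (∀ i → f i ≡ true → g i ≡ true ⊎ h i ≡ true) →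
            cnt f ≤ cnt g + cnt h
cnt-cover f g h c = subst (cnt f ≤_) (ℕSum.∑-distrib-+ (bit ∘ g) (bit ∘ h))
                      (sum-mono-≤ _ _ (λ i → bit-cover (c i)))

cnt-disjoint : ∀ {n} (f g h : Fin n → Bool) → (∀ i → f i ≡ true → h i ≡ true) →
               (∀ i → g i ≡ true → h i ≡ true) → (∀ i → f i ≡ true → g i ≡ true → ⊥) →
               cnt f + cnt g ≤ cnt h
cnt-disjoint f g h p q d = subst (_≤ cnt h) (ℕSum.∑-distrib-+ (bit ∘ f) (bit ∘ g))
                             (sum-mono-≤ _ _ (λ i → bit-disjoint (p i) (q i) (d i)))

cnt-pos : ∀ {n} (f : Fin n → Bool) {i} → f i ≡ true → 1 ≤ cnt f
cnt-pos f {zero}  e rewrite e = s≤s z≤n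
cnt-pos f {suc i} e = ≤-trans (cnt-pos (f ∘ suc) e) (m≤n+m _ (bit (f zero)))

cnt-witness : ∀ {n} (f : Fin n → Bool) → 1 ≤ cnt f → ∃[ i ] f i ≡ true
cnt-witness {suc n} f p with f zero in e
... | true  = zero , e
... | false = let i , q = cnt-witness (f ∘ suc) p in suc i , q

cnt-unique : ∀ {n} (f : Fin n → Bool) → cnt f ≤ 1 → ∀ {i j} → f i ≡ true → f j ≡ true → i ≡ j
cnt-unique f p {zero}  {zero}  _ _ = refl
cnt-unique f p {zero}  {suc j} e d rewrite e = contradiction (cnt-pos (f ∘ suc) d) (<⇒≱ p)
cnt-unique f p {suc i} {zero}  e d rewrite d = contradiction (cnt-pos (f ∘ suc) e) (<⇒≱ p)
cnt-unique f p {suc i} {suc j} e d =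
  cong suc (cnt-unique (f ∘ suc) (≤-trans (m≤n+m _ (bit (f zero))) p) e d)

cnt-none : ∀ {n} (f : Fin n → Bool) → (∀ i → f i ≡ false) → cnt f ≡ 0
cnt-none {zero}  f h = refl
cnt-none {suc n} f h rewrite h zero = cnt-none (f ∘ suc) (h ∘ suc)

cnt-single : ∀ {n} (f : Fin n → Bool) x → (∀ i → f i ≡ true → i ≡ x) → cnt f ≤ 1
cnt-single f zero h
  rewrite cnt-none (f ∘ suc) (λ i → ¬true⇒false (λ e → case h (suc i) e of λ ()))
  with f zero
... | true  = ≤-refl
... | false = z≤n
cnt-single f (suc x) h rewrite ¬true⇒false (λ e → case h zero e of λ ()) =
  cnt-single (f ∘ suc) x (λ i → Fin.suc-injective ∘ h (suc i))

cnt-initial : ∀ {n} m → cnt {n} (λ u → toℕ u <ᵇ m) ≤ m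
cnt-initial {zero}  m       = z≤n
cnt-initial {suc n} zero    = cnt-initial {n} zero
cnt-initial {suc n} (suc m) = s≤s (cnt-initial {n} m)

parity-none : ∀ {n} (f : Fin n → Bool) → (∀ i → f i ≡ false) → parity f ≡ false
parity-none {zero}  f h = refl
parity-none {suc n} f h rewrite h zero = parity-none (f ∘ suc) (h ∘ suc)

parity-single : ∀ {n} (f : Fin n → Bool) x → (∀ i → f i ≡ true → i ≡ x) → parity f ≡ f x
parity-single f zero h
  rewrite parity-none (f ∘ suc) (λ i → ¬true⇒false (λ e → case h (suc i) e of λ ())) =
  xor-identityʳ (f zero)
parity-single f (suc x) h rewrite ¬true⇒false (λ e → case h zero e of λ ()) =
  parity-single (f ∘ suc) x (λ i → Fin.suc-injective ∘ h (suc i))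

length-filter : ∀ {n} {A : Set} (f : A → Bool) (g : Fin n → A) →
                length (filterᵇ f (tabulate g)) ≡ cnt (f ∘ g)
length-filter {zero}  f g = refl
length-filter {suc n} f g with f (g zero)
... | true  = cong suc (length-filter f (g ∘ suc))
... | false = length-filter f (g ∘ suc)


suc-%2 : ∀ n b → n % 2 ≡ bit b → suc n % 2 ≡ bit (not b)
suc-%2 zero          false _ = refl
suc-%2 (suc zero)    true  _ = refl
suc-%2 (suc (suc n)) b     e = trans (%-cycle (suc n)) (suc-%2 n b (trans (sym (%-cycle n)) e))
  where
  %-cycle : ∀ m → suc (suc m) % 2 ≡ m % 2
  %-cycle m = trans (cong (_% 2) (+-comm 2 m)) ([m+n]%n≡m%n m 2)

cnt-%2 : ∀ {n} (f : Fin n → Bool) → cnt f % 2 ≡ bit (parity f)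
cnt-%2 {zero}  f = refl
cnt-%2 {suc n} f with f zero
... | true  = suc-%2 (cnt (f ∘ suc)) (parity (f ∘ suc)) (cnt-%2 (f ∘ suc))
... | false = cnt-%2 (f ∘ suc)

argmax : ∀ {n} (m : Fin n → ℕ) (f : Fin n → Bool) → ∃[ x ] f x ≡ true →
         ∃[ x ] f x ≡ true × (∀ y → f y ≡ true → m y ≤ m x)
argmax {suc n} m f (x₀ , e₀) with any? (λ i → f (suc i) ≟ᵇ true)
argmax {suc n} m f (zero , e₀) | no none =
  zero , e₀ , λ { zero _ → ≤-refl ; (suc y) e → contradiction (y , e) none }
argmax {suc n} m f (suc x , e₀) | no none = contradiction (x , e₀) none
... | yes some with argmax (m ∘ suc) (f ∘ suc) some
...   | x , e , max with m zero ≤? m (suc x) | f zero in e'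
...     | yes le | _     = suc x , e , λ { zero _ → le ; (suc y) q → max y q }
...     | no _   | false = suc x , e , λ { zero q → ⊥-elim (true≢false q e') ; (suc y) q → max y q }
...     | no nle | true  = zero , e' , λ { zero _ → ≤-refl ; (suc y) q → ≤-trans (max y q) (≰⇒≥ nle) }

-- Avoiding few vectors, and palettes

-- Halving: choose each bit so that at most half of the remaining vectors agree with it.
avoid : ∀ {n} t (C : Fin n → Bool) (b : Fin n → ℕ → Bool) → cnt C < 2 ^ t →
        Σ (ℕ → Bool) λ y → ∀ v → C v ≡ true → ∃[ h ] h < t × b v h xor y h ≡ true
avoid zero C b p = (λ _ → false) , λ v e → contradiction (cnt-pos C e) (<⇒≱ p)
avoid {n} (suc t) C b p = case cnt C₁ <? 2 ^ t of λ where
    (yes q) → let y , ok = avoid t C₁ (λ v → b v ∘ suc) q in cons true y , λ v e → split₁ y ok v e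
    (no ¬q) → let y , ok = avoid t C₀ (λ v → b v ∘ suc) (small ¬q) in cons false y , λ v e → split₀ y ok v e
  where
  C₀ C₁ : Fin n → Bool
  C₀ v = C v ∧ not (b v 0)
  C₁ v = C v ∧ b v 0
  cons : Bool → (ℕ → Bool) → ℕ → Bool
  cons x y zero    = x
  cons x y (suc h) = y h
  halves : cnt C₁ + cnt C₀ ≤ cnt C
  halves = cnt-disjoint C₁ C₀ C (λ v → ∧-conicalˡ _ _) (λ v → ∧-conicalˡ _ _)
    (λ v e d → true≢false (∧-conicalʳ (C v) _ d) (cong not (∧-conicalʳ (C v) _ e)))
  small : ¬ cnt C₁ < 2 ^ t → cnt C₀ < 2 ^ t
  small ¬q = ≰⇒> λ r → <-irrefl refl (≤-<-trans
    (≤-trans (+-mono-≤ (≮⇒≥ ¬q) r) halves) (subst (λ m → cnt C < 2 ^ t + m) (+-identityʳ (2 ^ t)) p))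
  split₁ : ∀ y → (∀ v → C₁ v ≡ true → ∃[ h ] h < t × b v (suc h) xor y h ≡ true) →
           ∀ v → C v ≡ true → ∃[ h ] h < suc t × b v h xor cons true y h ≡ true
  split₁ y ok v e with b v 0 in d
  ... | true  = let h , l , q = ok v (∧⁺ e d) in suc h , s≤s l , q
  ... | false = 0 , s≤s z≤n , cong (_xor true) d
  split₀ : ∀ y → (∀ v → C₀ v ≡ true → ∃[ h ] h < t × b v (suc h) xor y h ≡ true) →
           ∀ v → C v ≡ true → ∃[ h ] h < suc t × b v h xor cons false y h ≡ true
  split₀ y ok v e with b v 0 in d
  ... | true  = 0 , s≤s z≤n , cong (_xor false) d
  ... | false = let h , l , q = ok v (∧⁺ e (cong not d)) in suc h , s≤s l , q

_∈?_ : ∀ {N} (x : Fin N) (xs : List (Fin N)) → Dec (x ∈ xs)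
x ∈? xs = anyL? (x ≟_) xs

-- If all colours occurred in `xs`, mapping each to its position would send two colours to the same
-- position.
fresh : ∀ {N} (xs : List (Fin N)) → length xs < N → ∃[ c ] c ∉ xs
fresh {N} xs p = ¬∀⟶∃¬ N (_∈ xs) (_∈? xs) λ all →
  let i , j , i<j , e = pigeonhole p (index ∘ all) in
  Fin.<⇒≢ i<j (trans (lookup-index (all i)) (trans (cong (lookup xs) e) (sym (lookup-index (all j)))))

-- `a i` is the colour requested for place `i`. A request outside `xs` is always met, though
-- possibly at an earlier place, which is why `prefers` gives only `j ≤ i`.
record Palette {N} (xs : List (Fin N)) (m : ℕ) (a : ℕ → Fin N) : Set where
  field
    colour    : ℕ → Fin N
    avoids    : ∀ {i} → i < m → colour i ∉ xs
    injective : ∀ {i j} → i < m → j < m → colour i ≡ colour j → i ≡ j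
    prefers   : ∀ {i} → i < m → a i ∈ xs ⊎ ∃[ j ] j ≤ i × colour j ≡ a i

-- Greedy: place 0 takes its request if that is allowed and a fresh colour otherwise; the remaining
-- places then treat this colour as forbidden.
palette : ∀ {N} (xs : List (Fin N)) m (a : ℕ → Fin N) → length xs + m ≤ N → Palette xs m a
palette xs zero a p = record
  { colour = a ; avoids = λ () ; injective = λ () ; prefers = λ () }
palette {N} xs (suc m) a p = record
  { colour = colour ; avoids = avoids ; injective = injective ; prefers = prefers }
  where
  head : Σ (Fin N) λ c → c ∉ xs × (a 0 ∈ xs ⊎ c ≡ a 0)
  head with a 0 ∈? xs
  ... | no ∉xs  = a 0 , ∉xs , inj₂ refl
  ... | yes ∈xs = let c , ∉xs = fresh xs (≤-trans (≤-trans (s≤s (m≤m+n _ m)) (≤-reflexive (sym (+-suc _ m)))) p)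
                  in c , ∉xs , inj₁ ∈xs
  c₀ = proj₁ head
  tail : Palette (c₀ ∷ xs) m (a ∘ suc)
  tail = palette (c₀ ∷ xs) m (a ∘ suc) (subst (_≤ N) (+-suc (length xs) m) p)
  module T = Palette tail
  colour : ℕ → Fin N
  colour zero    = c₀
  colour (suc i) = T.colour i
  avoids : ∀ {i} → i < suc m → colour i ∉ xs
  avoids {zero}  _       = proj₁ (proj₂ head)
  avoids {suc i} (s≤s l) = T.avoids l ∘ there
  injective : ∀ {i j} → i < suc m → j < suc m → colour i ≡ colour j → i ≡ j
  injective {zero}  {zero}  _       _       _ = refl
  injective {zero}  {suc j} _       (s≤s l) e = contradiction (here (sym e)) (T.avoids l)
  injective {suc i} {zero}  (s≤s l) _       e = contradiction (here e) (T.avoids l)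
  injective {suc i} {suc j} (s≤s l) (s≤s r) e = cong suc (T.injective l r e)
  prefers : ∀ {i} → i < suc m → a i ∈ xs ⊎ ∃[ j ] j ≤ i × colour j ≡ a i
  prefers {zero} _ = Sum.map₂ (λ e → 0 , z≤n , e) (proj₂ (proj₂ head))
  prefers {suc i} (s≤s l) with T.prefers l
  -- The request is refused in the tail only because place 0 already holds it.
  ... | inj₁ (here e)      = inj₂ (0 , z≤n , sym e)
  ... | inj₁ (there ∈xs)   = inj₁ ∈xs
  ... | inj₂ (j , j≤i , e) = inj₂ (suc j , s≤s j≤i , e)

-- Bounds on the logarithm

m<2^m : ∀ m → m < 2 ^ m
m<2^m zero    = s≤s z≤n
m<2^m (suc m) = begin-strict
  suc m           ≡⟨ +-comm 1 m ⟩
  m + 1           <⟨ +-mono-<-≤ (m<2^m m) (m^n>0 2 m) ⟩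
  2 ^ m + 2 ^ m   ≡⟨ cong (2 ^ m +_) (sym (+-identityʳ _)) ⟩
  2 ^ suc m       ∎
  where open ≤-Reasoning

k<2^[1+⌊log₂k⌋] : ∀ k → k < 2 ^ suc ⌊log₂ k ⌋
k<2^[1+⌊log₂k⌋] k = ≰⇒> λ le → <-irrefl refl
  (subst (_≤ ⌊log₂ k ⌋) (⌊log₂[2^n]⌋≡n (suc ⌊log₂ k ⌋)) (⌊log₂⌋-mono-≤ le))

⌊log₂k⌋<k : ∀ {k} → 1 ≤ k → ⌊log₂ k ⌋ < k
⌊log₂k⌋<k {suc m} _ = s≤s (subst (⌊log₂ suc m ⌋ ≤_) (⌊log₂[2^n]⌋≡n m) (⌊log₂⌋-mono-≤ (m<2^m m)))

-- Ordered `k`-trees and their tree of bags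

-- The vertices are renumbered by the enumeration of the `k`-tree, so that `toℕ` is the order of
-- construction.
record OrderedKTree (k n : ℕ) : Set where
  field
    H           : Graph n
    1≤k         : 1 ≤ k
    k<n         : k < n
    root-clique : ∀ {u v} → toℕ u ≤ k → toℕ v ≤ k → u ≢ v → Edge H u v
    back-clique : ∀ {w u v} → k < toℕ w → toℕ u < toℕ w → toℕ v < toℕ w → u ≢ v →
                  Edge H w u → Edge H w v → Edge H u v
    back-count  : ∀ {w} → k < toℕ w → cnt (λ u → (toℕ u <ᵇ toℕ w) ∧ adj H w u) ≡ k

-- The bags K w ∪ {w}, k < w, together with the root clique form a tree of bags.
module Tree {k n} (T : OrderedKTree k n) where
  open OrderedKTree T public

  edge-sym : ∀ {u v} → Edge H u v → Edge H v u
  edge-sym {u} {v} = trans (Graph.sym H v u)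

  no-loop : ∀ {v} → ¬ Edge H v v
  no-loop {v} e = true≢false e (irrefl H v)

  root : Fin n
  root = fromℕ< k<n

  root≤k : toℕ root ≤ k
  root≤k = ≤-reflexive (toℕ-fromℕ< k<n)

  K : Fin n → Fin n → Bool
  K w u = (toℕ u <ᵇ toℕ w) ∧ adj H w u

  Q : Fin n → Fin n → Bool
  Q w u = if k <ᵇ toℕ w then ⌊ u ≟ w ⌋ ∨ K w u else (toℕ u <ᵇ suc k)

  K⁺ : ∀ {w u} → toℕ u < toℕ w → Edge H w u → K w u ≡ true
  K⁺ l e = ∧⁺ (<ᵇ⁺ l) e

  K-< : ∀ {w u} → K w u ≡ true → toℕ u < toℕ w
  K-< e = <ᵇ⁻ (∧-conicalˡ _ _ e)

  K-edge : ∀ {w u} → K w u ≡ true → Edge H w u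
  K-edge {w} {u} e = ∧-conicalʳ (toℕ u <ᵇ toℕ w) _ e

  Q-later : ∀ {w} → k < toℕ w → ∀ u → Q w u ≡ ⌊ u ≟ w ⌋ ∨ K w u
  Q-later l u rewrite <ᵇ⁺ l = refl

  Q-root : ∀ {w} → toℕ w ≤ k → ∀ u → Q w u ≡ (toℕ u <ᵇ suc k)
  Q-root l u rewrite ¬true⇒false (≤⇒≯ l ∘ <ᵇ⁻) = refl

  Q-later⁻ : ∀ {w u} → k < toℕ w → Q w u ≡ true → u ≡ w ⊎ K w u ≡ true
  Q-later⁻ {w} {u} l e =
    Sum.map₁ (⌊⌋⁻ (u ≟ w)) (∨⁻ ⌊ u ≟ w ⌋ (trans (sym (Q-later l u)) e))

  Q-root⁻ : ∀ {w u} → toℕ w ≤ k → Q w u ≡ true → toℕ u ≤ k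
  Q-root⁻ l e = s≤s⁻¹ (<ᵇ⁻ (trans (sym (Q-root l _)) e))

  Q-root⁺ : ∀ {w u} → toℕ w ≤ k → toℕ u ≤ k → Q w u ≡ true
  Q-root⁺ l m = trans (Q-root l _) (<ᵇ⁺ (s≤s m))

  Q-self : ∀ w → Q w w ≡ true
  Q-self w with k <? toℕ w
  ... | yes l = trans (Q-later l w) (cong (_∨ K w w) (⌊⌋⁺ (w ≟ w) refl))
  ... | no ¬l = Q-root⁺ (≮⇒≥ ¬l) (≮⇒≥ ¬l)

  K⇒Q : ∀ {w u} → k < toℕ w → K w u ≡ true → Q w u ≡ true
  K⇒Q {w} {u} l e with u ≟ w | Q-later l u
  ... | yes _ | q = q
  ... | no _  | q = trans q e

  Q-clique : ∀ q {u v} → Q q u ≡ true → Q q v ≡ true → u ≢ v → Edge H u v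
  Q-clique q {u} {v} a b u≢v with k <? toℕ q
  ... | no ¬l = root-clique (Q-root⁻ (≮⇒≥ ¬l) a) (Q-root⁻ (≮⇒≥ ¬l) b) u≢v
  ... | yes l with Q-later⁻ l a | Q-later⁻ l b
  ...   | inj₁ refl | inj₁ refl = contradiction refl u≢v
  ...   | inj₁ refl | inj₂ e    = K-edge e
  ...   | inj₂ e    | inj₁ refl = edge-sym (K-edge e)
  ...   | inj₂ d    | inj₂ e    = back-clique l (K-< d) (K-< e) u≢v (K-edge d) (K-edge e)

  cnt-K : ∀ {w} → k < toℕ w → cnt (K w) ≡ k
  cnt-K = back-count

  cnt-Q : ∀ q → cnt (Q q) ≤ suc k
  cnt-Q q with k <? toℕ q
  ... | no ¬l = ≤-trans (cnt-mono (Q q) _ (λ u e → trans (sym (Q-root (≮⇒≥ ¬l) u)) e)) (cnt-initial {n} (suc k))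
  ... | yes l = ≤-trans
    (cnt-cover (Q q) (λ u → ⌊ u ≟ q ⌋) (K q) (λ u e → Sum.map₁ (⌊⌋⁺ (u ≟ q)) (Q-later⁻ l e)))
    (+-mono-≤ (cnt-single (λ u → ⌊ u ≟ q ⌋) q (λ u → ⌊⌋⁻ (u ≟ q))) (≤-reflexive (cnt-K l)))

  -- The latest earlier neighbour, unless that lies in the root clique.
  abstract
    parent : ∀ w → Σ (Fin n) λ q →
      (k < toℕ w → ∀ {u} → K w u ≡ true → Q q u ≡ true) ×
      (k < toℕ w → toℕ q < toℕ w) × (toℕ q ≤ k → q ≡ root)
    parent w with k <? toℕ w
    ... | no ¬l = root , (λ l → contradiction l ¬l) , (λ l → contradiction l ¬l) , λ _ → refl
    ... | yes l with argmax toℕ (K w) (cnt-witness (K w) (subst (1 ≤_) (sym (cnt-K l)) 1≤k))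
    ...   | x , e , max with k <? toℕ x
    ...     | yes m = x , (λ _ → inner) , (λ _ → K-< e) , λ x≤k → contradiction x≤k (<⇒≱ m)
      where
      inner : ∀ {u} → K w u ≡ true → Q x u ≡ true
      inner {u} d = case u ≟ x of λ where
        (yes refl) → Q-self x
        -- By maximality `u` precedes `x`, and the two are adjacent because the earlier neighbours
        -- of `w` form a clique.
        (no u≢x)   → K⇒Q m (K⁺ (≤∧≢⇒< (max u d) (u≢x ∘ toℕ-injective))
                       (back-clique l (K-< e) (K-< d) (u≢x ∘ sym) (K-edge e) (K-edge d)))
    -- The latest earlier neighbour lies in the root clique, hence so do all the others.
    ...     | no ¬m = root , (λ _ d → Q-root⁺ root≤k (≤-trans (max _ d) (≮⇒≥ ¬m))) ,
                      (λ _ → ≤-<-trans root≤k l) , λ _ → refl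

  par : Fin n → Fin n
  par w = proj₁ (parent w)

  K⊆Q-par : ∀ {w u} → k < toℕ w → K w u ≡ true → Q (par w) u ≡ true
  K⊆Q-par {w} l = proj₁ (proj₂ (parent w)) l

  par-< : ∀ {w} → k < toℕ w → toℕ (par w) < toℕ w
  par-< {w} = proj₁ (proj₂ (proj₂ (parent w)))

  par-root : ∀ {w} → toℕ (par w) ≤ k → par w ≡ root
  par-root {w} = proj₂ (proj₂ (proj₂ (parent w)))

  dropped : Fin n → Fin n → Bool
  dropped w u = Q (par w) u ∧ not (K w u)

  -- The `k` earlier neighbours of `w` all lie in the parent's bag, which has at most `k + 1`
  -- members.
  cnt-dropped : ∀ {w} → k < toℕ w → cnt (dropped w) ≤ 1
  cnt-dropped {w} l = +-cancelˡ-≤ k (cnt (dropped w)) 1 (begin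
    k + cnt (dropped w)          ≡⟨ cong (_+ cnt (dropped w)) (sym (cnt-K l)) ⟩
    cnt (K w) + cnt (dropped w)  ≤⟨ cnt-disjoint (K w) (dropped w) (Q (par w))
                                      (λ u → K⊆Q-par l) (λ u → ∧-conicalˡ _ _)
                                      (λ u a b → true≢false (∧-conicalʳ (Q (par w) u) _ b) (cong not a)) ⟩
    cnt (Q (par w))              ≤⟨ cnt-Q (par w) ⟩
    suc k                        ≡⟨ +-comm 1 k ⟩
    k + 1                        ∎)
    where open ≤-Reasoning

  -- Descendants and separation

  data Below (q : Fin n) : Fin n → Set where
    child : ∀ {w} → k < toℕ w → par w ≡ q → Below q w
    step  : ∀ {w} → k < toℕ w → Below q (par w) → Below q w

  below-> : ∀ {q w} → Below q w → k < toℕ w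
  below-> (child l _) = l
  below-> (step l _)  = l

  below? : ∀ q w → Dec (Below q w)
  below? q w = go w (<-wellFounded (toℕ w))
    where
    go : ∀ w → Acc _<_ (toℕ w) → Dec (Below q w)
    go w (acc rs) with k <? toℕ w
    ... | no ¬l = no (¬l ∘ below->)
    ... | yes l with par w ≟ q
    ...   | yes e = yes (child l e)
    ...   | no ¬e with go (par w) (rs (par-< l))
    ...     | yes b = yes (step l b)
    ...     | no ¬b = no λ { (child _ e) → ¬e e ; (step _ b) → ¬b b }

  below-trans : ∀ {q w u} → Below q w → Below w u → Below q u
  below-trans b (child l refl) = step l b
  below-trans b (step l c)     = step l (below-trans b c)

  below-root : ∀ {w} → k < toℕ w → Below root w
  below-root {w} = go w (<-wellFounded (toℕ w))
    where
    go : ∀ w → Acc _<_ (toℕ w) → k < toℕ w → Below root w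
    go w (acc rs) l with k <? toℕ (par w)
    ... | yes m = step l (go (par w) (rs (par-< l)) m)
    ... | no ¬m = child l (par-root (≮⇒≥ ¬m))

  -- The bag of `par u` contains `w`, so `w` is either `par u` itself or an earlier neighbour of it;
  -- climbing from parent to parent ends at `w`.
  later-below : ∀ {w u} → k < toℕ w → K u w ≡ true → Below w u
  later-below {w} {u} l = go u (<-wellFounded (toℕ u))
    where
    go : ∀ u → Acc _<_ (toℕ u) → K u w ≡ true → Below w u
    go u (acc rs) e with <-trans l (K-< e)
    ... | m with k <? toℕ (par u)
    ...   | no ¬p = contradiction (Q-root⁻ (≮⇒≥ ¬p) (K⊆Q-par m e)) (<⇒≱ l)
    ...   | yes p with Q-later⁻ p (K⊆Q-par m e)
    ...     | inj₁ refl = child m refl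
    ...     | inj₂ d    = step m (go (par u) (rs (par-< m)) d)

  earlier-of-below : ∀ {q w z} → Below q w → K w z ≡ true → Q q z ≡ true ⊎ Below q z
  earlier-of-below (child l refl) e = inj₁ (K⊆Q-par l e)
  earlier-of-below (step l b) e with Q-later⁻ (below-> b) (K⊆Q-par l e)
  ... | inj₁ refl = inj₂ b
  ... | inj₂ d    = earlier-of-below b d

  edge-order : ∀ {u v} → Edge H u v → K u v ≡ true ⊎ K v u ≡ true
  edge-order {u} {v} e with <-cmp (toℕ u) (toℕ v)
  ... | tri< l _ _ = inj₂ (K⁺ l (edge-sym e))
  ... | tri> _ _ l = inj₁ (K⁺ l e)
  ... | tri≈ _ d _ with refl ← toℕ-injective d = contradiction e no-loop

  -- The bag of `q` cuts off the subtree below `q`: an earlier neighbour of `w` is passed up from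
  -- bag to bag until it is met as a vertex of the path or reaches `Q q`, and a later neighbour lies
  -- below `w`.
  separation : ∀ {q w z} → Below q w → Edge H w z → Q q z ≡ true ⊎ Below q z
  separation b e with edge-order e
  ... | inj₁ d = earlier-of-below b d
  ... | inj₂ d = inj₂ (below-trans b (later-below (below-> b) d))

  -- Depth and ancestors

  -- Passing to the parent is not structural recursion. Fuel `toℕ w` suffices, since the parent of a
  -- later vertex has a smaller number.
  depth-fuel : ℕ → Fin n → ℕ
  depth-fuel zero    w = 0
  depth-fuel (suc f) w = if k <ᵇ toℕ w then suc (depth-fuel f (par w)) else 0

  depth : Fin n → ℕ
  depth w = depth-fuel (toℕ w) w

  depth-fuel-enough : ∀ f g w → toℕ w ≤ f → toℕ w ≤ g → depth-fuel f w ≡ depth-fuel g w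
  depth-fuel-enough zero zero w _ _ = refl
  depth-fuel-enough zero (suc g) w l _ rewrite ¬true⇒false (≤⇒≯ (≤-trans l z≤n) ∘ <ᵇ⁻ {k} {toℕ w}) = refl
  depth-fuel-enough (suc f) zero w _ l rewrite ¬true⇒false (≤⇒≯ (≤-trans l z≤n) ∘ <ᵇ⁻ {k} {toℕ w}) = refl
  depth-fuel-enough (suc f) (suc g) w a b with k <ᵇ toℕ w in e
  ... | false = refl
  ... | true  = cong suc (depth-fuel-enough f g (par w) (shrink a) (shrink b))
    where
    shrink : ∀ {f} → toℕ w ≤ suc f → toℕ (par w) ≤ f
    shrink l = s≤s⁻¹ (≤-trans (par-< (<ᵇ⁻ e)) l)

  depth-unfold : ∀ w → depth w ≡ (if k <ᵇ toℕ w then suc (depth-fuel (toℕ w) (par w)) else 0)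
  depth-unfold w = depth-fuel-enough (toℕ w) (suc (toℕ w)) w ≤-refl (n≤1+n _)

  depth-root : ∀ {w} → toℕ w ≤ k → depth w ≡ 0
  depth-root {w} l = trans (depth-unfold w)
    (cong (if_then suc (depth-fuel (toℕ w) (par w)) else 0) (¬true⇒false (≤⇒≯ l ∘ <ᵇ⁻)))

  depth-later : ∀ {w} → k < toℕ w → depth w ≡ suc (depth (par w))
  depth-later {w} l = trans (depth-unfold w)
    (trans (cong (if_then suc (depth-fuel (toℕ w) (par w)) else 0) (<ᵇ⁺ l))
      (cong suc (depth-fuel-enough (toℕ w) (toℕ (par w)) (par w) (<⇒≤ (par-< l)) ≤-refl)))

  depth-pos : ∀ {w} → 0 < depth w → k < toℕ w
  depth-pos p = ≰⇒> λ l → <-irrefl (sym (depth-root l)) p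

  below-depth : ∀ {q w} → Below q w → depth q < depth w
  below-depth (child l refl) = ≤-reflexive (sym (depth-later l))
  below-depth (step l b) = <-trans (below-depth b) (≤-reflexive (sym (depth-later l)))

  ancestor : Fin n → ℕ → Fin n
  ancestor w zero    = w
  ancestor w (suc h) = par (ancestor w h)

  depth-ancestor : ∀ p {h} → h ≤ depth p → depth (ancestor p h) ≡ depth p ∸ h
  ancestor-later : ∀ p {h} → h < depth p → k < toℕ (ancestor p h)

  depth-ancestor p {zero}  _ = refl
  depth-ancestor p {suc h} l = suc-injective (begin
    suc (depth (ancestor p (suc h)))  ≡⟨ sym (depth-later (ancestor-later p l)) ⟩
    depth (ancestor p h)              ≡⟨ depth-ancestor p (<⇒≤ l) ⟩
    depth p ∸ h                       ≡⟨ ∸-suc l ⟩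
    suc (depth p ∸ suc h)             ∎)
    where
    open ≡-Reasoning
    ∸-suc : ∀ {m h} → h < m → m ∸ h ≡ suc (m ∸ suc h)
    ∸-suc {suc m} {h} (s≤s r) = +-∸-assoc 1 r

  ancestor-later p {h} l = depth-pos (subst (0 <_) (sym (depth-ancestor p (<⇒≤ l))) (m<n⇒0<n∸m l))

  ancestor-below : ∀ p {h j} → j ≤ depth p → h < j → Below (ancestor p j) (ancestor p h)
  ancestor-below p {h} {suc j} l (s≤s h≤j) with m≤n⇒m<n∨m≡n h≤j
  ... | inj₂ refl = child (ancestor-later p l) refl
  ... | inj₁ h<j  = below-trans (child (ancestor-later p l) refl) (ancestor-below p (<⇒≤ l) h<j)

  -- A member of `Q q` other than `q` is either in the root clique, which is below nothing, or has
  -- `q` below it; being below `q` too would contradict the depths.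
  Q-not-below : ∀ {q u} → Q q u ≡ true → ¬ Below q u
  Q-not-below {q} e b with k <? toℕ q
  ... | no ¬l = <⇒≱ (below-> b) (Q-root⁻ (≮⇒≥ ¬l) e)
  ... | yes l with Q-later⁻ l e
  ...   | inj₁ refl = <-irrefl refl (below-depth b)
  ...   | inj₂ d    = <-asym (below-depth b) (below-depth (later-below (below-> b) d))

  -- A child of `q` has `k` neighbours in `Q q`, and each further level loses at most one, the
  -- dropped vertex. Hence vertices at most `k` levels below `q` still have a neighbour in `Q q`.
  cnt-K∧Q : ∀ {q w} → Below q w → suc k + depth q ≤ cnt (λ u → K w u ∧ Q q u) + depth w
  cnt-K∧Q {q} {w} (child l refl) = begin
    suc k + depth q                         ≡⟨ sym (+-suc k (depth q)) ⟩
    k + suc (depth q)                       ≡⟨ cong₂ _+_ (sym (cnt-K l)) (sym (depth-later l)) ⟩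
    cnt (K w) + depth w                     ≤⟨ +-monoˡ-≤ (depth w) (cnt-mono (K w) _ (λ u e → ∧⁺ e (K⊆Q-par l e))) ⟩
    cnt (λ u → K w u ∧ Q q u) + depth w     ∎
    where open ≤-Reasoning
  cnt-K∧Q {q} {w} (step l b) = begin
    suc k + depth q                                       ≤⟨ cnt-K∧Q b ⟩
    cnt (λ u → K (par w) u ∧ Q q u) + depth (par w)       ≤⟨ +-monoˡ-≤ (depth (par w)) lose-one ⟩
    (cnt (λ u → K w u ∧ Q q u) + 1) + depth (par w)       ≡⟨ +-assoc _ 1 (depth (par w)) ⟩
    cnt (λ u → K w u ∧ Q q u) + suc (depth (par w))       ≡⟨ cong (cnt (λ u → K w u ∧ Q q u) +_) (sym (depth-later l)) ⟩
    cnt (λ u → K w u ∧ Q q u) + depth w                   ∎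
    where
    open ≤-Reasoning
    cover : ∀ u → K (par w) u ∧ Q q u ≡ true →
            K w u ∧ Q q u ≡ true ⊎ dropped w u ≡ true
    cover u e with K w u
    ... | true  = inj₁ (∧-conicalʳ (K (par w) u) _ e)
    ... | false = inj₂ (∧⁺ (K⇒Q (below-> b) (∧-conicalˡ _ _ e)) refl)
    lose-one : cnt (λ u → K (par w) u ∧ Q q u) ≤ cnt (λ u → K w u ∧ Q q u) + 1
    lose-one = ≤-trans (cnt-cover _ (λ u → K w u ∧ Q q u) (dropped w) cover)
      (+-monoʳ-≤ (cnt (λ u → K w u ∧ Q q u)) (cnt-dropped l))

-- Odd colourings of induced subgraphs

module Colouring {k n} (T : OrderedKTree k n) (N : ℕ) where
  open Tree T

  sees : (Fin n → Bool) → (Fin n → Fin N) → Fin n → Fin N → Fin n → Bool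
  sees D φ v i u = (D u ∧ adj H v u) ∧ ⌊ φ u ≟ i ⌋

  nb : (Fin n → Bool) → (Fin n → Fin N) → Fin n → Fin N → Bool
  nb D φ v i = parity (sees D φ v i)

  -- Every vertex of `D` has to be odd, with no exception for isolated ones. The odd colours form a
  -- function because later colour requests refer to them.
  record OddOn (D : Fin n → Bool) (φ : Fin n → Fin N) : Set where
    field
      proper  : ∀ {u v} → D u ≡ true → D v ≡ true → Edge H u v → φ u ≢ φ v
      witness : Fin n → Fin N
      odd     : ∀ {v} → D v ≡ true → nb D φ v (witness v) ≡ true

  -- These are the vertex sets on which the induction runs: subtrees of the tree of bags that
  -- contain the root clique. They contain the whole bag of each member.
  record Closed (D : Fin n → Bool) : Set where
    field
      has-root   : ∀ {w} → toℕ w ≤ k → D w ≡ true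
      has-parent : ∀ {w} → k < toℕ w → D w ≡ true → D (par w) ≡ true

    has-bag : ∀ {w u} → D w ≡ true → Q w u ≡ true → D u ≡ true
    has-bag {w} = go w (<-wellFounded (toℕ w))
      where
      go : ∀ w {u} → Acc _<_ (toℕ w) → D w ≡ true → Q w u ≡ true → D u ≡ true
      go w (acc rs) d e with k <? toℕ w
      ... | no ¬l = has-root (Q-root⁻ (≮⇒≥ ¬l) e)
      ... | yes l with Q-later⁻ l e
      ...   | inj₁ refl = d
      ...   | inj₂ c    = go (par w) (rs (par-< l)) (has-parent l d) (K⊆Q-par l c)

    has-ancestor : ∀ {p h} → D p ≡ true → h ≤ depth p → D (ancestor p h) ≡ true
    has-ancestor {h = zero}  d _ = d
    has-ancestor {p} {suc h} d l = has-parent (ancestor-later p l) (has-ancestor d (<⇒≤ l))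

  nb-single : ∀ D φ v i x → (∀ {u} → D u ≡ true → Edge H v u → φ u ≡ i → u ≡ x) →
              nb D φ v i ≡ sees D φ v i x
  nb-single D φ v i x h = parity-single (sees D φ v i) x λ u e →
    let d , c = ∧⁻ (D u ∧ adj H v u) e in
    h (∧-conicalˡ _ _ d) (∧-conicalʳ (D u) _ d) (⌊⌋⁻ (φ u ≟ i) c)

  nb-none : ∀ D φ v i → (∀ {u} → D u ≡ true → Edge H v u → φ u ≢ i) → nb D φ v i ≡ false
  nb-none D φ v i h = parity-none (sees D φ v i) λ u → ¬true⇒false λ e →
    let d , c = ∧⁻ (D u ∧ adj H v u) e in
    h (∧-conicalˡ _ _ d) (∧-conicalʳ (D u) _ d) (⌊⌋⁻ (φ u ≟ i) c)

  sees⁺ : ∀ (D : Fin n → Bool) (φ : Fin n → Fin N) v x → D x ≡ true → Edge H v x → sees D φ v (φ x) x ≡ true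
  sees⁺ D φ v x d e = ∧⁺ (∧⁺ d e) (⌊⌋⁺ (φ x ≟ φ x) refl)

  inside outside : Fin n → (Fin n → Bool) → Fin n → Bool
  inside  q D u = D u ∧ ⌊ below? q u ⌋
  outside q D u = D u ∧ not ⌊ below? q u ⌋

  inside⁺ : ∀ {q D u} → D u ≡ true → Below q u → inside q D u ≡ true
  inside⁺ {q} {u = u} d b = ∧⁺ d (⌊⌋⁺ (below? q u) b)

  inside⁻ : ∀ {q} D {u} → inside q D u ≡ true → D u ≡ true × Below q u
  inside⁻ {q} D {u} e = ∧-conicalˡ _ _ e , ⌊⌋⁻ (below? q u) (∧-conicalʳ (D u) _ e)

  outside⁺ : ∀ {q D u} → D u ≡ true → ¬ Below q u → outside q D u ≡ true
  outside⁺ {q} {u = u} d ¬b = ∧⁺ d (cong not (⌊⌋-false (below? q u) ¬b))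

  outside⁻ : ∀ {q} D {u} → outside q D u ≡ true → D u ≡ true × ¬ Below q u
  outside⁻ {q} D {u} e = ∧-conicalˡ _ _ e ,
    λ b → true≢false (∧-conicalʳ (D u) _ e) (cong not (⌊⌋⁺ (below? q u) b))

  outside-closed : ∀ {q D} → Closed D → Closed (outside q D)
  outside-closed {q} {D} cl = record
    { has-root   = λ l → outside⁺ {q} {D} (has-root l) (λ b → <⇒≱ (below-> b) l)
    ; has-parent = λ l e → let d , ¬b = outside⁻ D e in
                     outside⁺ {q} {D} (has-parent l d) (¬b ∘ step l)
    }
    where open Closed cl

  -- Recolouring everything below a vertex

  module Extend (D : Fin n → Bool) (q : Fin n) (φ′ col : Fin n → Fin N) where

    φ : Fin n → Fin N
    φ u = if ⌊ below? q u ⌋ then col u else φ′ u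

    φ-below : ∀ {u} → Below q u → φ u ≡ col u
    φ-below {u} b = cong (if_then col u else φ′ u) (⌊⌋⁺ (below? q u) b)

    φ-not-below : ∀ {u} → ¬ Below q u → φ u ≡ φ′ u
    φ-not-below {u} ¬b = cong (if_then col u else φ′ u) (⌊⌋-false (below? q u) ¬b)

    -- Each vertex of `D` is either below `q` or not, so the parity seen by `v` is the xor of an old
    -- and a new contribution.
    nb-split : ∀ v i → nb D φ v i ≡ nb (outside q D) φ′ v i xor nb (inside q D) col v i
    nb-split v i = trans (XorSum.sum-cong-≗ pointwise)
      (XorSum.∑-distrib-+ (sees (outside q D) φ′ v i) (sees (inside q D) col v i))
      where
      pointwise : ∀ u → sees D φ v i u ≡ sees (outside q D) φ′ v i u xor sees (inside q D) col v i u
      pointwise u with D u | ⌊ below? q u ⌋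
      ... | false | _     = refl
      ... | true  | true  = refl
      ... | true  | false = sym (xor-identityʳ _)

    nb-old : ∀ v i → (∀ {u} → inside q D u ≡ true → Edge H v u → col u ≢ i) →
             nb D φ v i ≡ nb (outside q D) φ′ v i
    nb-old v i h = trans (nb-split v i)
      (trans (cong (nb (outside q D) φ′ v i xor_) (nb-none (inside q D) col v i h)) (xor-identityʳ _))

    -- Only the oddness of `Q q` is left as a hypothesis. Vertices below `q` are odd through a
    -- neighbour in the bag, and vertices neither below `q` nor in its bag gain no neighbours, by
    -- `separation`.
    extend : Closed D → D q ≡ true → OddOn (outside q D) φ′ →
             (∀ {w u} → inside q D w ≡ true → Q q u ≡ true → col w ≢ φ′ u) →
             (∀ {w u} → inside q D w ≡ true → inside q D u ≡ true → Edge H w u → col w ≢ col u) →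
             (∀ {w} → inside q D w ≡ true → depth w ≤ k + depth q) →
             (∀ {v} → Q q v ≡ true → ∃[ i ] nb D φ v i ≡ true) →
             OddOn D φ
    extend cl Dq old col-bag col-inside near bag-odd = record
      { proper = proper ; witness = λ v → proj₁ (choose v) ; odd = λ {v} → proj₂ (choose v) }
      where
      open Closed cl
      module O = OddOn old

      bag-outside : ∀ {u} → Q q u ≡ true → outside q D u ≡ true
      bag-outside e = outside⁺ {q} {D} (has-bag Dq e) (Q-not-below e)

      mixed : ∀ {u v} → D u ≡ true → Below q u → ¬ Below q v → Edge H u v → φ u ≢ φ v
      mixed {u} {v} d b ¬c e eq with separation b e
      ... | inj₁ a = col-bag (inside⁺ {q} {D} d b) a (trans (sym (φ-below b)) (trans eq (φ-not-below ¬c)))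
      ... | inj₂ c = ¬c c

      proper : ∀ {u v} → D u ≡ true → D v ≡ true → Edge H u v → φ u ≢ φ v
      proper {u} {v} d d′ e = case below? q u , below? q v of λ where
        (yes b , yes c) eq → col-inside (inside⁺ {q} {D} d b) (inside⁺ {q} {D} d′ c) e
                               (trans (sym (φ-below b)) (trans eq (φ-below c)))
        (yes b , no ¬c)    → mixed d b ¬c e
        (no ¬b , yes c) eq → mixed d′ c ¬b (edge-sym e) (sym eq)
        (no ¬b , no ¬c) eq → O.proper (outside⁺ {q} {D} d ¬b) (outside⁺ {q} {D} d′ ¬c) e
                               (trans (sym (φ-not-below ¬b)) (trans eq (φ-not-below ¬c)))

      bag-neighbour : ∀ {w} → inside q D w ≡ true → ∃[ z ] Q q z ≡ true × Edge H w z
      bag-neighbour {w} e =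
        let z , f = cnt-witness (λ u → K w u ∧ Q q u) (+-cancelʳ-≤ (k + depth q) 1 _
                      (≤-trans (cnt-K∧Q (proj₂ (inside⁻ D e)))
                        (+-monoʳ-≤ (cnt (λ u → K w u ∧ Q q u)) (near e))))
        in z , ∧-conicalʳ (K w z) _ f , K-edge (∧-conicalˡ _ _ f)

      inside-odd : ∀ {w} → inside q D w ≡ true → ∃[ i ] nb D φ w i ≡ true
      inside-odd {w} e with bag-neighbour e
      -- The colour of `z` is seen once: new colours avoid those of the bag, and the remaining
      -- neighbours of `w` lie in `Q q`, a clique.
      ... | z , a , f = φ z , trans (nb-single D φ w (φ z) z only) (sees⁺ D φ w z (has-bag Dq a) f)
        where
        only : ∀ {u} → D u ≡ true → Edge H w u → φ u ≡ φ z → u ≡ z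
        only {u} d g eq = case below? q u of λ where
          (yes b) → contradiction (trans (sym (φ-below b)) (trans eq (φ-not-below (Q-not-below a))))
                      (col-bag (inside⁺ {q} {D} d b) a)
          (no ¬b) → case separation (proj₂ (inside⁻ D e)) g of λ where
            (inj₂ b) → contradiction b ¬b
            (inj₁ c) → case u ≟ z of λ where
              (yes u≡z) → u≡z
              (no u≢z)  → contradiction
                (trans (sym (φ-not-below ¬b)) (trans eq (φ-not-below (Q-not-below a))))
                (O.proper (bag-outside c) (bag-outside a) (Q-clique q c a u≢z))

      choose : ∀ v → Σ (Fin N) λ i → D v ≡ true → nb D φ v i ≡ true
      choose v with D v in d | below? q v | Q q v in a
      -- Outside `D` the colour `φ v` is a mere default.
      ... | false | _      | _     = φ v , λ ()
      ... | true  | yes b  | _     = let i , o = inside-odd (inside⁺ {q} {D} d b) in i , λ _ → o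
      ... | true  | no _   | true  = let i , o = bag-odd a in i , λ _ → o
      ... | true  | no ¬b  | false = O.witness v , λ _ →
        trans (nb-old v _ λ e f → case separation (proj₂ (inside⁻ D e)) (edge-sym f) of λ where
                 (inj₁ c) → λ _ → true≢false c a
                 (inj₂ b) → λ _ → ¬b b)
              (O.odd (outside⁺ {q} {D} d ¬b))

  -- q is the ancestor of p by t levels, or the root if p is not that deep.
  module Levels (D : Fin n → Bool) (cl : Closed D) (p q : Fin n) (Dq : D q ≡ true)
                (deepest : ∀ w → D w ≡ true → depth w ≤ depth p)
                (t : ℕ) (t≤k : t ≤ k) (p-q : depth p ≤ t + depth q) (colours : suc k + (t + t) ≤ N)
                (φ′ : Fin n → Fin N) (old : OddOn (outside q D) φ′) (a : ℕ → Fin N) where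
    module O = OddOn old
    open Closed cl

    bag-colours : List (Fin N)
    bag-colours = map φ′ (filterᵇ (Q q) (allFin n))

    bag-colours⁺ : ∀ {u} → Q q u ≡ true → φ′ u ∈ bag-colours
    bag-colours⁺ {u} e = ∈-map⁺ φ′ (∈-filter⁺ (T? ∘ Q q) (∈-allFin u) (subst True (sym e) _))

    length-bag-colours : length bag-colours ≤ suc k
    length-bag-colours = subst (_≤ suc k)
      (sym (trans (length-map φ′ (filterᵇ (Q q) (allFin n))) (length-filter (Q q) id))) (cnt-Q q)

    open Palette (palette bag-colours (t + t) a (≤-trans (+-monoˡ-≤ (t + t) length-bag-colours) colours)) public

    level : Fin n → ℕ
    level w = depth p ∸ depth w

    level-< : ∀ {w} → inside q D w ≡ true → level w < t
    level-< {w} e = let d , b = inside⁻ D e in begin-strict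
      depth p ∸ depth w        <⟨ ∸-monoʳ-< (below-depth b) (deepest w d) ⟩
      depth p ∸ depth q        ≤⟨ ∸-monoˡ-≤ (depth q) p-q ⟩
      t + depth q ∸ depth q    ≡⟨ m+n∸n≡m t (depth q) ⟩
      t                        ∎
      where open ≤-Reasoning

    main : ℕ → Fin n
    main = ancestor p

    module Bits (y : ℕ → Bool) where

      special : Fin n → Bool
      special w = ⌊ w ≟ main (level w) ⌋ ∧ y (level w)

      -- Level h, counted upwards from p, has βₕ = colour h and αₕ = colour (t + h).
      slot : Fin n → ℕ
      slot w = if special w then level w else t + level w

      col : Fin n → Fin N
      col w = colour (slot w)

      open Extend D q φ′ col public

      slot-< : ∀ {w} → inside q D w ≡ true → slot w < t + t
      slot-< {w} e with special w
      ... | true  = ≤-trans (level-< e) (m≤m+n t t)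
      ... | false = +-monoʳ-< t (level-< e)

      -- Slots below `t` and slots from `t` on form two blocks, and within each block the slot
      -- determines the level.
      slot-level : ∀ {w u} → inside q D w ≡ true → inside q D u ≡ true → slot w ≡ slot u → level w ≡ level u
      slot-level {w} {u} e f eq with special w | special u
      ... | true  | true  = eq
      ... | false | false = +-cancelˡ-≡ t _ _ eq
      ... | true  | false = contradiction (subst (_< t) eq (level-< e)) (m+n≮m t (level u))
      ... | false | true  = contradiction (subst (_< t) (sym eq) (level-< f)) (m+n≮m t (level w))

      col-avoids : ∀ {w} → inside q D w ≡ true → col w ∉ bag-colours
      col-avoids e = avoids (slot-< e)

      -- Of two adjacent vertices here one lies below the other, so their levels differ, and
      -- different levels share no colour.
      col-inside : ∀ {w u} → inside q D w ≡ true → inside q D u ≡ true → Edge H w u → col w ≢ col u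
      col-inside {w} {u} e f g eq = case edge-order g of λ where
          (inj₁ c) → <-irrefl (sym same) (below-depth (later-below (below-> (proj₂ (inside⁻ D f))) c))
          (inj₂ c) → <-irrefl same (below-depth (later-below (below-> (proj₂ (inside⁻ D e))) c))
        where
        same : depth w ≡ depth u
        same = ∸-cancelˡ-≡ (deepest w (proj₁ (inside⁻ D e))) (deepest u (proj₁ (inside⁻ D f)))
                 (slot-level e f (injective (slot-< e) (slot-< f) eq))

      finish : (∀ {v} → Q q v ≡ true → ∃[ i ] nb D φ v i ≡ true) → OddOn D φ
      finish = extend cl Dq old
        (λ e a eq → col-avoids e (subst (_∈ bag-colours) (sym eq) (bag-colours⁺ a)))
        col-inside
        (λ {w} e → ≤-trans (deepest w (proj₁ (inside⁻ D e))) (≤-trans p-q (+-monoˡ-≤ (depth q) t≤k)))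

      witness-in-bag : ∀ {v} → Q q v ≡ true → O.witness v ∈ bag-colours → nb D φ v (O.witness v) ≡ true
      witness-in-bag {v} e m = trans
        (nb-old v _ (λ c _ eq → col-avoids c (subst (_∈ bag-colours) (sym eq) m)))
        (O.odd (outside⁺ {q} {D} (has-bag Dq e) (Q-not-below e)))

      col-special : ∀ {h w} → h < t → inside q D w ≡ true → col w ≡ colour h → w ≡ main h × y h ≡ true
      col-special {h} {w} l e eq with special w in s | injective (slot-< e) (≤-trans l (m≤m+n t t)) eq
      ... | true  | refl = let a , b = ∧⁻ ⌊ w ≟ main (level w) ⌋ s in ⌊⌋⁻ (w ≟ main (level w)) a , b
      ... | false | refl = contradiction l (m+n≮m t (level w))

    -- Bag vertices and the path from `p` up to `q`

    module Path (Dp : D p ≡ true) (t≤p : t ≤ depth p) (q≡ : q ≡ main t) where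

      main-later : ∀ {h} → h < t → k < toℕ (main h)
      main-later l = ancestor-later p (≤-trans l t≤p)

      main-below : ∀ {h} → h < t → Below q (main h)
      main-below {h} l = subst (λ x → Below x (main h)) (sym q≡) (ancestor-below p t≤p l)

      main-inside : ∀ {h} → h < t → inside q D (main h) ≡ true
      main-inside l = inside⁺ {q} {D} (has-ancestor Dp (≤-trans (<⇒≤ l) t≤p)) (main-below l)

      level-main : ∀ {h} → h < t → level (main h) ≡ h
      level-main {h} l = trans (cong (depth p ∸_) (depth-ancestor p h≤p)) (m∸[m∸n]≡n h≤p)
        where h≤p = ≤-trans (<⇒≤ l) t≤p

      not-main : ∀ {v h} → Q q v ≡ true → h < t → v ≢ main h
      not-main e l refl = Q-not-below e (main-below l)

      bag-edge⇒K : ∀ {v h} → Q q v ≡ true → h < t → Edge H v (main h) → K (main h) v ≡ true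
      bag-edge⇒K e l f with edge-order f
      ... | inj₂ c = c
      ... | inj₁ c = contradiction (below-trans (main-below l) (later-below (below-> (main-below l)) c)) (Q-not-below e)

      -- A neighbour of a path vertex lies in the next bag up, and as a member of `Q q` it is not
      -- itself on the path below `q`. So going down, contact once lost is never regained.
      K-upward : ∀ {v i} j → Q q v ≡ true → i ≤ j → j < t → K (main i) v ≡ true → K (main j) v ≡ true
      K-upward {v} {i} j e i≤j l c with m≤n⇒m<n∨m≡n i≤j
      ... | inj₂ refl = c
      K-upward {v} {i} (suc j) e _ l c | inj₁ (s≤s i≤j)
        with Q-later⁻ (main-later l)
               (K⊆Q-par (main-later (<⇒≤ l)) (K-upward j e i≤j (<⇒≤ l) c))
      ... | inj₁ v≡ = contradiction v≡ (not-main e l)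
      ... | inj₂ d  = d

      -- Descend from `main j` until a path vertex is no longer adjacent to `v`; this happens at `p`
      -- at the latest.
      find-drop : ∀ {v} j → j ≤ t → 0 < t → Q q v ≡ true → Q (main j) v ≡ true → ¬ (K p v ≡ true) →
                  ∃[ h ] h < j × dropped (main h) v ≡ true
      find-drop zero l 0<t e f ¬c with Q-later⁻ (main-later 0<t) f
      ... | inj₁ v≡p = contradiction v≡p (not-main e 0<t)
      ... | inj₂ c   = contradiction c ¬c
      find-drop {v} (suc j) l 0<t e f ¬c with K (main j) v in c
      ... | true  = let h , h<j , d = find-drop j (<⇒≤ l) 0<t e (K⇒Q (main-later l) c) ¬c
                    in h , ≤-trans h<j (n≤1+n j) , d
      ... | false = j , ≤-refl , ∧⁺ f (cong not c)

      -- A witness occurring on the bag survives. Otherwise a neighbour of `p` is served by the bits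
      -- (`core`), and any other vertex keeps its old witness (`away`).
      bag-odd : 0 < t → (y : ℕ → Bool) →
                (∀ v → K p v ≡ true → ∃[ h ] h < t × nb (outside q D) φ′ v (colour h) xor y h ≡ true) →
                (∀ {h v} → h < t → dropped (main h) v ≡ true → a h ≡ O.witness v) →
                ∀ {v} → Q q v ≡ true → ∃[ i ] nb D (Bits.φ y) v i ≡ true
      bag-odd 0<t y y-ok a-ok {v} e = case O.witness v ∈? bag-colours of λ where
          (yes m) → O.witness v , witness-in-bag e m
          (no ∉bag) → case K p v ≟ᵇ true of λ where
            (yes c) → core c
            (no ¬c) → away ∉bag ¬c
        where
        open Bits y

        core : K p v ≡ true → ∃[ i ] nb D φ v i ≡ true
        core c = let h , l , o = y-ok v c in
          -- `v` is adjacent to the whole path, so for each level `h` its parity of `colour h`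
          -- changes by exactly `y h`.
          colour h , trans (nb-split v (colour h)) (trans (cong (nb (outside q D) φ′ v (colour h) xor_) (new l)) o)
          where
          new : ∀ {h} → h < t → nb (inside q D) col v (colour h) ≡ y h
          new {h} l = trans
            (nb-single (inside q D) col v (colour h) (main h) (λ d _ eq → proj₁ (col-special l d eq)))
            hit
            where
            edge : Edge H v (main h)
            edge = edge-sym (K-edge (K-upward h e z≤n l c))
            slot-main : slot (main h) ≡ (if y h then h else t + h)
            slot-main rewrite level-main l | ⌊⌋⁺ (main h ≟ main h) refl = refl
            col≟ : ⌊ col (main h) ≟ colour h ⌋ ≡ y h
            col≟ with y h in s
            ... | true  = ⌊⌋⁺ (_ ≟ _) (cong colour (trans slot-main (cong (if_then h else t + h) s)))
            ... | false = ⌊⌋-false (_ ≟ _) λ eq →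
              true≢false (proj₂ (col-special l (main-inside l) eq)) s
            hit : sees (inside q D) col v (colour h) (main h) ≡ y h
            hit = trans (cong (_∧ ⌊ col (main h) ≟ colour h ⌋) (∧⁺ (main-inside l) edge)) col≟

        away : O.witness v ∉ bag-colours → ¬ (K p v ≡ true) → ∃[ i ] nb D φ v i ≡ true
        away ∉bag ¬c with find-drop t ≤-refl 0<t e (subst (λ x → Q x v ≡ true) q≡ e) ¬c
        ... | h , l , d with prefers {h} (≤-trans l (m≤m+n t t))
        ...   | inj₁ m = contradiction (subst (_∈ bag-colours) (a-ok l d) m) ∉bag
        -- Below `q` only `main j` can carry the old witness. As `j ≤ h`, it lies at or beneath the
        -- level where `v` was dropped, so `v` does not see it.
        ...   | inj₂ (j , j≤h , eq) = O.witness v , trans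
          (nb-old v _ λ {u} c f eq′ → unseen {u} c f (trans eq′ (sym (trans eq (a-ok l d)))))
          (O.odd (outside⁺ {q} {D} (has-bag Dq e) (Q-not-below e)))
          where
          j<t = ≤-<-trans j≤h l
          unseen : ∀ {u} → inside q D u ≡ true → Edge H v u → col u ≢ colour j
          unseen c f eq′ with refl , _ ← col-special j<t c eq′ =
            true≢false (∧-conicalʳ (Q (par (main h)) v) _ d)
              (cong not (K-upward h e j≤h l (bag-edge⇒K e j<t f)))

  -- The induction on the number of vertices

  module Induction (t : ℕ) (0<t : 0 < t) (t≤k : t ≤ k) (k<2^t : k < 2 ^ t) (colours : suc k + (t + t) ≤ N) where

    -- This matters only on the root clique, where it is injective; colour 0 is the default for
    -- vertex numbers that are too large.
    initial : Fin n → Fin N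
    initial u with toℕ u <? N
    ... | yes l = fromℕ< l
    ... | no _  = fromℕ< (≤-trans (s≤s z≤n) colours)

    initial-injective : ∀ {u v} → toℕ u ≤ k → toℕ v ≤ k → initial u ≡ initial v → u ≡ v
    initial-injective {u} {v} a b eq with toℕ u <? N | toℕ v <? N
    ... | yes l | yes m = toℕ-injective (trans (sym (toℕ-fromℕ< l)) (trans (cong toℕ eq) (toℕ-fromℕ< m)))
    ... | no ¬l | _     = contradiction (≤-trans (s≤s a) (≤-trans (m≤m+n (suc k) (t + t)) colours)) ¬l
    ... | yes _ | no ¬m = contradiction (≤-trans (s≤s b) (≤-trans (m≤m+n (suc k) (t + t)) colours)) ¬m

    other : ∀ v → ∃[ z ] toℕ z ≤ k × v ≢ z
    other v with toℕ v in e
    ... | zero  = fromℕ< 1<n , subst (_≤ k) (sym (toℕ-fromℕ< 1<n)) 1≤k ,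
                  λ { refl → case trans (sym e) (toℕ-fromℕ< 1<n) of λ () }
      where 1<n = ≤-<-trans 1≤k k<n
    ... | suc m = fromℕ< 0<n , subst (_≤ k) (sym (toℕ-fromℕ< 0<n)) z≤n ,
                  λ { refl → case trans (sym e) (toℕ-fromℕ< 0<n) of λ () }
      where 0<n = ≤-<-trans z≤n k<n

    -- Every later vertex is below `root`, so what remains is the root clique with distinct colours,
    -- where any other member provides a witness.
    root-odd : ∀ {D} → Closed D → OddOn (outside root D) initial
    root-odd {D} cl = record
      { proper  = λ d e f eq → no-loop (subst (Edge H _) (sym (initial-injective (early d) (early e) eq)) f)
      ; witness = λ v → initial (proj₁ (other v))
      ; odd     = λ {v} d → let z , z≤k , v≢z = other v in trans
          (nb-single (outside root D) initial v (initial z) z (λ e _ → initial-injective (early e) z≤k))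
          (sees⁺ (outside root D) initial v z
            (outside⁺ {root} {D} (Closed.has-root cl z≤k) (λ b → <⇒≱ (below-> b) z≤k))
            (root-clique (early d) z≤k v≢z))
      }
      where
      early : ∀ {u} → outside root D u ≡ true → toℕ u ≤ k
      early e = ≮⇒≥ (proj₂ (outside⁻ D e) ∘ below-root)

    odd-colouring : ∀ D → Closed D → Acc _<_ (cnt D) → Σ (Fin n → Fin N) (OddOn D)
    odd-colouring D cl (acc rs) with argmax depth D (root , Closed.has-root cl root≤k)
    ... | p , Dp , deepest with t ≤? depth p
    ...   | no t≰p = φ , finish λ {v} e → O.witness v , witness-in-bag e
                       (bag-colours⁺ (Q-root⁺ root≤k (proj₁ (proj₂ (other v)))))
      where
      -- All witnesses are colours of the bag, so the requests may take the default value
      -- `initial p`.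
      open Levels D cl p root (Closed.has-root cl root≤k) deepest t t≤k
             (≤-trans (<⇒≤ (≰⇒> t≰p)) (m≤m+n t _)) colours initial (root-odd cl) (λ _ → initial p)
      open Bits (λ _ → false)
    ...   | yes t≤p = φ , finish (bag-odd 0<t (proj₁ bits) (proj₂ bits) preferred-ok)
      where
      q = ancestor p t

      p-q : depth p ≤ t + depth q
      p-q = ≤-reflexive (trans (sym (m+[n∸m]≡n t≤p)) (cong (t +_) (sym (depth-ancestor p t≤p))))

      smaller : cnt (outside q D) < cnt D
      smaller = subst (_≤ cnt D) (+-comm (cnt (outside q D)) 1)
        (≤-trans (+-monoʳ-≤ (cnt (outside q D)) (cnt-pos (inside q D) (inside⁺ {q} {D} Dp (ancestor-below p t≤p 0<t))))
          (cnt-disjoint (outside q D) (inside q D) D (λ u → ∧-conicalˡ _ _) (λ u → ∧-conicalˡ _ _)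
            (λ u a b → proj₂ (outside⁻ D a) (proj₂ (inside⁻ D b)))))

      ih = odd-colouring (outside q D) (outside-closed cl) (rs smaller)
      φ′ = proj₁ ih
      old = proj₂ ih

      -- Level `h` requests the old odd colour of the vertex dropped there. There is at most one
      -- such vertex, so the search finds the right one; `φ′ p` is the default if there is none.
      preferred : ℕ → Fin N
      preferred h with any? (λ x → dropped (ancestor p h) x ≟ᵇ true)
      ... | yes (x , _) = OddOn.witness old x
      ... | no _        = φ′ p

      open Levels D cl p q (Closed.has-ancestor cl Dp t≤p) deepest t t≤k p-q
             colours φ′ old preferred
      open Path Dp t≤p refl

      -- With the palette fixed, each of the `k < 2 ^ t` neighbours in `K p` has a vector of old
      -- parities for the first `t` colours. The bits must differ from it at some level, which makes
      -- that parity odd.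
      bits = avoid t (K p) (λ v h → nb (outside q D) φ′ v (colour h))
               (subst (_< 2 ^ t) (sym (cnt-K (main-later 0<t))) k<2^t)

      open Bits (proj₁ bits)

      preferred-ok : ∀ {h v} → h < t → dropped (main h) v ≡ true → preferred h ≡ O.witness v
      preferred-ok {h} {v} l d with any? (λ x → dropped (ancestor p h) x ≟ᵇ true)
      ... | yes (x , e) = cong O.witness
        (cnt-unique (dropped (main h)) (cnt-dropped (main-later l)) e d)
      ... | no none     = contradiction (v , d) none

-- The number of colours and the return to the original graph

orderedKTree-odd : ∀ {k n} (T : OrderedKTree k n) → let N = k + 2 * ⌊log₂ k ⌋ + 3 in
  Σ (Fin n → Fin N) (Colouring.OddOn T N (λ _ → true))
orderedKTree-odd {k} T = odd-colouring (λ _ → true)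
  (record { has-root = λ _ → refl ; has-parent = λ _ _ → refl }) (<-wellFounded _)
  where
  L = ⌊log₂ k ⌋
  colours : suc k + (suc L + suc L) ≤ k + 2 * L + 3
  colours = ≤-reflexive (solve 2 (λ k L → (con 1 :+ k) :+ ((con 1 :+ L) :+ (con 1 :+ L)) :=
                                          (k :+ con 2 :* L) :+ con 3) refl k L)
  open Colouring T (k + 2 * L + 3)
  open Induction (suc L) (s≤s z≤n) (⌊log₂k⌋<k (OrderedKTree.1≤k T)) (k<2^[1+⌊log₂k⌋] k) colours

ordered : ∀ {k n} (G : Graph n) (kt : IsKTree k G) → 1 ≤ k →
          Σ (OrderedKTree k n) λ T → ∀ p q →
            adj (OrderedKTree.H T) p q ≡ adj G (Inverse.to (proj₁ (proj₂ (proj₂ kt))) p)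
                                               (Inverse.to (proj₁ (proj₂ (proj₂ kt))) q)
ordered {k} {n} G (s , refl , σ , root-edges , back) 1≤k = record
  { H           = record { adj    = λ p q → adj G (x p) (x q)
                         ; sym    = λ p q → Graph.sym G (x p) (x q)
                         ; irrefl = λ p → irrefl G (x p) }
  ; 1≤k         = 1≤k
  ; k<n         = subst (λ m → k < m + s) (+-comm 1 k) (m≤m+n (suc k) s)
  ; root-clique = λ l m → root-edges _ _ (s≤s l) (s≤s m)
  ; back-clique = λ {w} l a b → proj₁ (back w l) _ _ a b
  ; back-count  = λ {w} l → trans (sym (length-filter (λ u → (toℕ u <ᵇ toℕ w) ∧ adj G (x w) (x u)) id))
                                  (proj₂ (back w l))
  } , λ _ _ → refl
  where x = Inverse.to σ

theorem1p3 : (k : ℕ) → 1 ≤ k → (n : ℕ) → (G : Graph n) → IsKTree k G →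
    OddColorable (k + 2 * ⌊log₂ k ⌋ + 3) G
theorem1p3 k 1≤k n G kt@(_ , _ , σ , _) with ordered G kt 1≤k
... | T , adj≡ with orderedKTree-odd T
...   | φ , odd-on = ψ , proper , λ v _ → witness (from v) , odd-count v
  where
  open Colouring.OddOn odd-on using (witness; odd) renaming (proper to φ-proper)
  open OrderedKTree T using (H)
  to from : Fin n → Fin n
  to   = Inverse.to σ
  from = Inverse.from σ

  to-from : ∀ v → to (from v) ≡ v
  to-from v = Inverse.inverseˡ σ refl

  from-to : ∀ p → from (to p) ≡ p
  from-to p = Inverse.inverseʳ σ refl

  ψ : Fin n → Fin (k + 2 * ⌊log₂ k ⌋ + 3)
  ψ v = φ (from v)

  adj-from : ∀ u v → adj G u v ≡ adj H (from u) (from v)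
  adj-from u v = sym (trans (adj≡ _ _) (cong₂ (adj G) (to-from u) (to-from v)))

  proper : IsColoring G ψ
  proper u v e = φ-proper refl refl (trans (sym (adj-from u v)) e)

  -- Modulo 2 the count is a xor-sum, which may be reindexed along the enumeration `σ`; this turns
  -- it into the parity in the ordered graph.
  odd-count : ∀ v → Odd (nbColorCount G ψ v (witness (from v)))
  odd-count v = begin
    nbColorCount G ψ v i % 2  ≡⟨ cong (_% 2) (length-filter f id) ⟩
    cnt f % 2                 ≡⟨ cnt-%2 f ⟩
    bit (parity f)            ≡⟨ cong bit (XorSum.sum-permute f σ) ⟩
    bit (parity (f ∘ to))     ≡⟨ cong bit (XorSum.sum-cong-≗ pointwise) ⟩
    bit (Colouring.nb T _ (λ _ → true) φ (from v) i)
                              ≡⟨ cong bit (odd refl) ⟩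
    1                         ∎
    where
    open ≡-Reasoning
    i = witness (from v)
    f : Fin n → Bool
    f u = adj G v u ∧ ⌊ ψ u ≟ i ⌋
    pointwise : ∀ p → f (to p) ≡ adj H (from v) p ∧ ⌊ φ p ≟ i ⌋
    pointwise p = cong₂ (λ a q → a ∧ ⌊ φ q ≟ i ⌋)
      (trans (adj-from v (to p)) (cong (adj H (from v)) (from-to p))) (from-to p)
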